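{- Let $n,k$ be integers with $2<2k\le n$. The feasible set of the integer program $(*)$ is non-empty if and only if $\mathrm{Pet}(n,k)$ contains an odd cycle. Moreover, suppose $(\mathsf{u},\mathsf{v}_+,\mathsf{v}_-,r,t)$ is a solution of $(*)$. If $(*)$ has some trivial solution, then $g_{odd}(\mathrm{Pet}(n,k))=2r+1$; if all solutions of $(*)$ are nontrivial, then $g_{odd}(\mathrm{Pet}(n,k))=2r+3$.
   Context: For integers $n,k$ with $2<2k\le n$, the generalized Petersen graph $\mathrm{Pet}(n,k)$ has vertex set $\{u_0,\dots,u_{n-1}\}\cup\{v_0,\dots,v_{n-1}\}$ and edge set $\{u_iu_{i+1}\}\cup\{u_iv_i\}\cup\{v_iv_{i+k}\}$, indices modulo $n$. The integer program $(*)$ is: minimize $\mathsf{u}+\mathsf{v}_++\mathsf{v}_-$ over integers $\mathsf{u},\mathsf{v}_+,\mathsf{v}_-,r\ge 0$ and $t\in\mathbb{Z}$ subject to $\mathsf{u}+k(\mathsf{v}_+-\mathsf{v}_-)=tn$ and $\mathsf{u}+\mathsf{v}_++\mathsf{v}_-=2r+1$. A feasible point is any tuple satisfying these constraints; a solution is a minimizer; a solution is trivial if $\mathsf{u}=0$ or $\mathsf{v}_++\mathsf{v}_-=0$, and nontrivial otherwise (note all solutions have the same value $2r+1$). $g_{odd}(G)$ is the length of a shortest odd cycle of $G$. -}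

module Defs where

open import Data.Fin.Base using (Fin; toℕ)
open import Data.Fin.Properties using (nonZeroIndex)
import Data.Integer.Base as ℤ
open ℤ using (ℤ; +_)
open import Data.Nat.Base using (ℕ; _+_; _*_; _≤_)
open import Data.Nat.DivMod using (_mod_)
open import Data.Product.Base using (∃; _×_)
open import Data.Sum.Base using (_⊎_)
open import Function.Definitions using (Injective)
open import Level using (0ℓ)
open import Relation.Binary.Core using (Rel)
open import Relation.Binary.Construct.Closure.Symmetric using (SymClosure)
open import Relation.Binary.PropositionalEquality using (_≡_)
open import Relation.Nullary.Negation using (¬_)

Odd : ℕ → Set
Odd m = ∃ λ r → m ≡ 2 * r + 1

_⊕_ : ∀ {n} → Fin n → ℕ → Fin n
_⊕_ {n} i m = ((toℕ i + m) mod n) {{nonZeroIndex i}}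

-- A graph is given by its adjacency relation.  The vertices of a cycle are
-- listed in cyclic order, so a cycle is an embedding of Fin length in which
-- cyclically consecutive positions are adjacent.
record Cycle {V : Set} (_~_ : Rel V 0ℓ) (length : ℕ) : Set where
  field
    3≤length  : 3 ≤ length
    vertex    : Fin length → V
    injective : Injective _≡_ _≡_ vertex
    adjacent  : ∀ i → vertex i ~ vertex (i ⊕ 1)

HasOddCycle : {V : Set} → Rel V 0ℓ → Set
HasOddCycle _~_ = ∃ λ m → Odd m × Cycle _~_ m

-- "g_odd = g", as a relation because g_odd is undefined (or infinite) for a
-- graph without odd cycles.
record IsOddGirth {V : Set} (_~_ : Rel V 0ℓ) (g : ℕ) : Set where
  field
    odd      : Odd g
    attained : Cycle _~_ g
    minimal  : ∀ m → Odd m → Cycle _~_ m → g ≤ m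

data Vertex (n : ℕ) : Set where
  u v : Fin n → Vertex n

data PetEdge (n k : ℕ) : Rel (Vertex n) 0ℓ where
  outer : ∀ i → PetEdge n k (u i) (u (i ⊕ 1))
  spoke : ∀ i → PetEdge n k (u i) (v i)
  inner : ∀ i → PetEdge n k (v i) (v (i ⊕ k))

Pet : (n k : ℕ) → Rel (Vertex n) 0ℓ
Pet n k = SymClosure (PetEdge n k)

record Point : Set where
  constructor point
  field
    𝗎 𝗏₊ 𝗏₋ r : ℕ
    t : ℤ

  objective : ℕ
  objective = 𝗎 + 𝗏₊ + 𝗏₋

open Point public

record Feasible (n k : ℕ) (p : Point) : Set where
  field
    winding : + 𝗎 p ℤ.+ + k ℤ.* (+ 𝗏₊ p ℤ.- + 𝗏₋ p) ≡ t p ℤ.* + n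
    parity  : 𝗎 p + 𝗏₊ p + 𝗏₋ p ≡ 2 * r p + 1

record Solution (n k : ℕ) (p : Point) : Set where
  field
    feasible : Feasible n k p
    minimal  : ∀ q → Feasible n k q → objective p ≤ objective q

Trivial : Point → Set
Trivial p = 𝗎 p ≡ 0 ⊎ 𝗏₊ p + 𝗏₋ p ≡ 0

Nontrivial : Point → Set
Nontrivial p = ¬ Trivial p

{-# OPTIONS --safe #-}
module Submission where

-- Counting the outer and inner edges of an odd cycle by direction, and cancelling opposite
-- outer edges, gives a feasible point whose value is at most the number of non-spoke edges.
-- The number of spokes is even, and if it is 0 then the cycle is purely outer or purely inner
-- and the point is trivial.  This yields the lower bounds.  Conversely an optimal point has
-- 𝗏₊ = 0 or 𝗏₋ = 0.  A trivial one is traced by an outer or an inner cycle; a nontrivial one by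
-- an outer path and an inner path joined by two spokes, which costs 2 extra edges.  No vertex
-- is repeated, since a repetition would split the point into two, one of them odd and smaller.

open import Defs
open import Data.Fin.Base using (Fin; toℕ; fromℕ<)
open import Data.Fin.Properties using (nonZeroIndex; toℕ-fromℕ<; toℕ-injective; toℕ<n)
open import Data.Integer.Base as ℤ using (ℤ; +_; 0ℤ; 1ℤ; ∣_∣)
open import Data.Integer.DivMod using (_%ℕ_; _/ℕ_; n%ℕd<d; a≡a%ℕn+[a/ℕn]*n)
open import Data.Integer.Divisibility.Signed
  using (_∣_; divides; _∣?_; ∣⇒∣ᵤ; ∣m∣n⇒∣m+n; ∣m+n∣m⇒∣n; ∣m⇒∣-m)
import Data.Integer.Properties as ℤ
open import Data.Integer.Tactic.RingSolver using () renaming (solve-∀ to ℤ-solve-∀)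
open import Data.Nat.Base
  using (ℕ; zero; suc; _+_; _*_; _∸_; _≤_; _<_; z≤n; s≤s; z<s; s<s; NonZero; ≢-nonZero)
open import Data.Nat.DivMod using (_%_; m<n⇒m%n≡m; n%n≡0)
import Data.Nat.Divisibility as ℕ
open import Data.Nat.Induction using (<-rec)
open import Data.Nat.Properties
open import Data.Nat.Tactic.RingSolver using (solve-∀)
open import Data.Product.Base using (∃; _×_; _,_; proj₁; proj₂)
open import Data.Sum.Base using (_⊎_; inj₁; inj₂)
open import Function.Base using (_∘_)
open import Function.Bundles using (_⇔_; mk⇔)
open import Level using (0ℓ)
open import Relation.Binary.Core using (Rel)
open import Relation.Binary.Construct.Closure.Symmetric using (fwd; bwd)
open import Relation.Binary.Definitions using (tri<; tri≈; tri>)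
open import Relation.Binary.PropositionalEquality
  using (_≡_; _≢_; refl; sym; trans; cong; cong₂; subst; subst₂)
open import Relation.Nullary using (¬_; Dec; yes; no; contradiction; _×-dec_; _⊎-dec_)
import Relation.Nullary.Decidable as Dec

-- Congruence modulo `n` and residues in `Fin n`

∣∧<⇒≡0 : ∀ {n d} → n ℕ.∣ d → d < n → d ≡ 0
∣∧<⇒≡0 {d = zero} _ _ = refl
∣∧<⇒≡0 {d = suc d} n∣d d<n = contradiction d<n (≤⇒≯ (ℕ.∣⇒≤ n∣d))

module Congruence (n : ℕ) where

  infix 4 _≋_

  -- A record rather than a synonym for the divisibility, so that `x` and `y` can be inferred from
  -- the type of a proof.
  record _≋_ (x y : ℤ) : Set where
    constructor congruent
    field difference : + n ∣ x ℤ.- y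

  open _≋_ public

  ≋-refl : ∀ {x} → x ≋ x
  ≋-refl {x} = congruent (divides 0ℤ (ℤ.+-inverseʳ x))

  ≋-sym : ∀ {x y} → x ≋ y → y ≋ x
  ≋-sym {x} {y} (congruent p) = congruent (subst (+ n ∣_) (eq x y) (∣m⇒∣-m p))
    where
    eq : ∀ x y → ℤ.- (x ℤ.- y) ≡ y ℤ.- x
    eq = ℤ-solve-∀

  ≋-trans : ∀ {x y z} → x ≋ y → y ≋ z → x ≋ z
  ≋-trans {x} {y} {z} (congruent p) (congruent q) =
    congruent (subst (+ n ∣_) (eq x y z) (∣m∣n⇒∣m+n p q))
    where
    eq : ∀ x y z → (x ℤ.- y) ℤ.+ (y ℤ.- z) ≡ x ℤ.- z
    eq = ℤ-solve-∀

  ≋-+ʳ : ∀ {x y} z → x ≋ y → x ℤ.+ z ≋ y ℤ.+ z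
  ≋-+ʳ {x} {y} z (congruent p) = congruent (subst (+ n ∣_) (eq x y z) p)
    where
    eq : ∀ x y z → x ℤ.- y ≡ (x ℤ.+ z) ℤ.- (y ℤ.+ z)
    eq = ℤ-solve-∀

  -- Two residues below `n` differ by less than `n` in absolute value, so a difference divisible by
  -- `n` is 0.
  toℕ-≋-injective : ∀ {i j : Fin n} → + toℕ i ≋ + toℕ j → i ≡ j
  toℕ-≋-injective {i} {j} i≋j =
    toℕ-injective (ℤ.+-injective (ℤ.i-j≡0⇒i≡j _ _ (ℤ.∣i∣≡0⇒i≡0
      (∣∧<⇒≡0 (∣⇒∣ᵤ (difference i≋j)) (bound (toℕ<n i) (toℕ<n j))))))
    where
    bound : ∀ {a b} → a < n → b < n → ∣ + a ℤ.- + b ∣ < n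
    bound {a} {b} a<n b<n rewrite ℤ.m-n≡m⊖n a b with ≤-total a b
    ... | inj₁ a≤b rewrite ℤ.∣⊖∣-≤ a≤b = ≤-<-trans (m∸n≤m b a) b<n
    ... | inj₂ b≤a rewrite ℤ.⊖-≥ b≤a = ≤-<-trans (m∸n≤m a b) a<n

  module _ .{{_ : NonZero n}} where

    %ℕ-≋ : ∀ x → + (x %ℕ n) ≋ x
    %ℕ-≋ x = ≋-sym (congruent (divides (x /ℕ n)
      (trans (cong (ℤ._- + (x %ℕ n)) (a≡a%ℕn+[a/ℕn]*n x n)) (eq (+ (x %ℕ n)) _))))
      where
      eq : ∀ a b → (a ℤ.+ b) ℤ.- a ≡ b
      eq = ℤ-solve-∀

    [_] : ℤ → Fin n
    [ x ] = fromℕ< (n%ℕd<d x n)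

    toℕ-[] : ∀ x → + toℕ [ x ] ≋ x
    toℕ-[] x rewrite toℕ-fromℕ< (n%ℕd<d x n) = %ℕ-≋ x

    []-cong : ∀ x y → x ≋ y → [ x ] ≡ [ y ]
    []-cong x y x≋y =
      toℕ-≋-injective (≋-trans (toℕ-[] x) (≋-trans x≋y (≋-sym (toℕ-[] y))))

    []-injective : ∀ x y → [ x ] ≡ [ y ] → x ≋ y
    []-injective x y eq = ≋-trans (≋-sym (toℕ-[] x))
      (subst (λ i → + toℕ i ≋ y) (sym eq) (toℕ-[] y))

  toℕ-⊕ : ∀ (i : Fin n) m → + toℕ (i ⊕ m) ≋ + toℕ i ℤ.+ + m
  toℕ-⊕ i m = subst (λ a → + a ≋ + (toℕ i + m))
    (sym (toℕ-fromℕ< _)) (%ℕ-≋ {{nonZeroIndex i}} (+ (toℕ i + m)))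

  []-⊕ : .{{_ : NonZero n}} → ∀ x m → [ x ] ⊕ m ≡ [ x ℤ.+ + m ]
  []-⊕ x m = toℕ-≋-injective (≋-trans (toℕ-⊕ [ x ] m)
    (≋-trans (≋-+ʳ (+ m) (toℕ-[] x)) (≋-sym (toℕ-[] (x ℤ.+ + m)))))

-- Parity of natural numbers

even-or-odd : ∀ m → (∃ λ q → m ≡ 2 * q) ⊎ Odd m
even-or-odd zero = inj₁ (0 , refl)
even-or-odd (suc m) with even-or-odd m
... | inj₁ (q , eq) = inj₂ (q , trans (cong suc eq) (+-comm 1 (2 * q)))
... | inj₂ (q , eq) = inj₁ (suc q , trans (cong suc eq) (lemma q))
  where
  lemma : ∀ q → suc (2 * q + 1) ≡ 2 * suc q
  lemma = solve-∀

odd-+ : ∀ x y → Odd (x + y) → Odd x ⊎ Odd y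
odd-+ x y (r , eq) with even-or-odd x | even-or-odd y
... | inj₂ ox | _ = inj₁ ox
... | inj₁ _ | inj₂ oy = inj₂ oy
... | inj₁ (p , refl) | inj₁ (q , refl) = contradiction
  (trans (*-distribˡ-+ 2 p q) (trans eq (+-comm (2 * r) 1))) (even≢odd (p + q) r)

-- Cycles and concatenated paths as sequences

module _ {V : Set} {_~_ : Rel V 0ℓ} where

  -- On indices in `ℕ` the cyclic successor is `suc`, except at the last index, where it wraps to 0;
  -- `step` and `close` cover these two cases.
  cycleFromSequence : ∀ (f : ℕ → V) {l} → 3 ≤ l →
    (∀ {i} → suc i < l → f i ~ f (suc i)) →
    (∀ {i} → suc i ≡ l → f i ~ f 0) →
    (∀ {i j} → i < j → j < l → f i ≢ f j) →
    Cycle _~_ l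
  cycleFromSequence f {suc l} 3≤l step close distinct = record
    { 3≤length  = 3≤l
    ; vertex    = f ∘ toℕ
    ; injective = λ {i} {j} → injective i j
    ; adjacent  = adjacent
    }
    where
    injective : ∀ (i j : Fin (suc l)) → f (toℕ i) ≡ f (toℕ j) → i ≡ j
    injective i j eq with <-cmp (toℕ i) (toℕ j)
    ... | tri≈ _ i≡j _ = toℕ-injective i≡j
    ... | tri< i<j _ _ = contradiction eq (distinct i<j (toℕ<n j))
    ... | tri> _ _ j<i = contradiction (sym eq) (distinct j<i (toℕ<n i))

    adjacent : ∀ (i : Fin (suc l)) → f (toℕ i) ~ f (toℕ (i ⊕ 1))
    adjacent i rewrite toℕ-fromℕ< (n%ℕd<d (+ (toℕ i + 1)) (suc l)) | +-comm (toℕ i) 1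
      with m≤n⇒m<n∨m≡n (toℕ<n i)
    ... | inj₁ si<l rewrite m<n⇒m%n≡m si<l = step si<l
    ... | inj₂ si≡l rewrite cong (_% suc l) si≡l | n%n≡0 (suc l) {{_}} = close si≡l

module _ {V : Set} where

  -- Recursion on the length `a` of the first segment, instead of a comparison of `i` with `a`,
  -- turns the proofs below into plain inductions.
  splice : ℕ → (ℕ → V) → (ℕ → V) → ℕ → V
  splice zero    f g i       = g i
  splice (suc a) f g zero    = f 0
  splice (suc a) f g (suc i) = splice a (f ∘ suc) g i

  splice-right : ∀ a f g j → splice a f g (a + j) ≡ g j
  splice-right zero    f g j = refl
  splice-right (suc a) f g j = splice-right a (f ∘ suc) g j

  splice-all : ∀ (P : V → Set) a {b} f g →
    (∀ {i} → i < a → P (f i)) → (∀ {i} → i < b → P (g i)) →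
    ∀ {i} → i < a + b → P (splice a f g i)
  splice-all P zero    f g Pf Pg i<b = Pg i<b
  splice-all P (suc a) f g Pf Pg {zero}  _         = Pf z<s
  splice-all P (suc a) f g Pf Pg {suc i} (s<s i<)  =
    splice-all P a (f ∘ suc) g (Pf ∘ s<s) Pg i<

  splice-distinct : ∀ a {b} f g →
    (∀ {i j} → i < j → j < a → f i ≢ f j) →
    (∀ {i j} → i < a → j < b → f i ≢ g j) →
    (∀ {i j} → i < j → j < b → g i ≢ g j) →
    ∀ {i j} → i < j → j < a + b → splice a f g i ≢ splice a f g j
  splice-distinct zero f g ff fg gg i<j j< = gg i<j j<
  splice-distinct (suc a) f g ff fg gg {zero} {suc j} _ (s<s j<) =
    splice-all (f 0 ≢_) a (f ∘ suc) g (λ i< → ff z<s (s<s i<)) (fg z<s) j<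
  splice-distinct (suc a) f g ff fg gg {suc i} {suc j} (s<s i<j) (s<s j<) =
    splice-distinct a (f ∘ suc) g (λ p q → ff (s<s p) (s<s q)) (fg ∘ s<s) gg i<j j<

  -- The first segment has `suc a` entries, so `f a` is its last one and the joining edge leaves
  -- from there.
  splice-step : ∀ (_~_ : Rel V 0ℓ) a {b} f g →
    (∀ {i} → i < a → f i ~ f (suc i)) → f a ~ g 0 →
    (∀ {i} → suc i < b → g i ~ g (suc i)) →
    ∀ {i} → suc i < suc a + b → splice (suc a) f g i ~ splice (suc a) f g (suc i)
  splice-step _~_ zero    f g ff fg gg {zero}  _       = fg
  splice-step _~_ zero    f g ff fg gg {suc i} (s<s p) = gg p
  splice-step _~_ (suc a) f g ff fg gg {zero}  _       = ff z<s
  splice-step _~_ (suc a) f g ff fg gg {suc i} (s<s p) =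
    splice-step _~_ a (f ∘ suc) g (ff ∘ s<s) fg gg p

-- Cycles traced by optimal points

-- κ = k or κ = −k, so that the two directions of the inner edges are treated at once.
module Construction
  {n k : ℕ} .{{_ : NonZero n}} (κ : ℤ)
  (inner-step : ∀ x → Pet n k (v (Congruence.[_] n x)) (v (Congruence.[_] n (x ℤ.+ κ))))
  (n∤1 : ¬ (+ n ∣ 1ℤ)) (n∤κ : ¬ (+ n ∣ κ))
  (a b : ℕ) (odd : Odd (a + b)) (closed : + n ∣ + a ℤ.+ κ ℤ.* + b)
  (minimal : ∀ a′ b′ → Odd (a′ + b′) → + n ∣ + a′ ℤ.+ κ ℤ.* + b′ → a + b ≤ a′ + b′)
  where

  open Congruence n

  +-exchange : ∀ c c′ d d′ → (c + c′) + (d + d′) ≡ (c + d) + (c′ + d′)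
  +-exchange = solve-∀

  -- Of a closed part and its complement in the shortest odd closed walk, one is odd and
  -- would be shorter.
  no-shortcut : ∀ {c d} → c ≤ a → d ≤ b → 0 < c + d → c + d < a + b →
    ¬ (+ n ∣ + c ℤ.+ κ ℤ.* + d)
  no-shortcut {c} {d} c≤a d≤b 0<c+d c+d<a+b part
    with m≤n⇒∃[o]m+o≡n c≤a | m≤n⇒∃[o]m+o≡n d≤b
  ... | c′ , refl | d′ , refl
    with odd-+ (c + d) (c′ + d′) (subst Odd (+-exchange c c′ d d′) odd)
  ...   | inj₁ o = contradiction (minimal c d o part) (<⇒≱ c+d<a+b)
  ...   | inj₂ o = contradiction (minimal c′ d′ o rest) (<⇒≱ (begin-strict
    c′ + d′              <⟨ m<n+m (c′ + d′) 0<c+d ⟩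
    (c + d) + (c′ + d′)  ≡⟨ +-exchange c d c′ d′ ⟩
    (c + c′) + (d + d′)  ∎))
    where
    open ≤-Reasoning
    split : ∀ κ c c′ d d′ → (c ℤ.+ c′) ℤ.+ κ ℤ.* (d ℤ.+ d′)
                          ≡ (c ℤ.+ κ ℤ.* d) ℤ.+ (c′ ℤ.+ κ ℤ.* d′)
    split = ℤ-solve-∀
    rest : + n ∣ + c′ ℤ.+ κ ℤ.* + d′
    rest = ∣m+n∣m⇒∣n (subst (+ n ∣_) (split κ (+ c) (+ c′) (+ d) (+ d′)) closed) part

  pos-∸ : ∀ {i j} → i < j → + (j ∸ i) ≡ + j ℤ.- + i
  pos-∸ {i} {j} i<j = sym (trans (ℤ.m-n≡m⊖n j i) (ℤ.⊖-≥ (<⇒≤ i<j)))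

  -- The inner sequence starts at position `a`, where the outer path ends with `us a`; `closed`
  -- brings `vs b` back to position 0.
  us vs : ℕ → Vertex n
  us i = u [ + i ]
  vs j = v [ + a ℤ.+ κ ℤ.* + j ]

  us-step : ∀ i → Pet n k (us i) (us (suc i))
  us-step i = subst (Pet n k (us i) ∘ u)
    (trans ([]-⊕ (+ i) 1) (cong (λ j → [ + j ]) (+-comm i 1))) (fwd (outer [ + i ]))

  vs-step : ∀ j → Pet n k (vs j) (vs (suc j))
  vs-step j = subst (λ x → Pet n k (vs j) (v [ x ])) (next κ (+ a) (+ j))
    (inner-step (+ a ℤ.+ κ ℤ.* + j))
    where
    next : ∀ κ a j → a ℤ.+ κ ℤ.* j ℤ.+ κ ≡ a ℤ.+ κ ℤ.* (1ℤ ℤ.+ j)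
    next = ℤ-solve-∀

  -- A repetition would close up a stretch of `j ∸ i` outer edges, against `no-shortcut`. The bound
  -- `j < a + b` makes this stretch a proper part: when `b` is 0, `us a` does coincide with `us 0`.
  us-distinct : ∀ {i j} → i < j → j ≤ a → j < a + b → us i ≢ us j
  us-distinct {i} {j} i<j j≤a j<a+b eq = no-shortcut {j ∸ i} {0}
    (≤-trans (m∸n≤m j i) j≤a) z≤n
    (subst (0 <_) (sym (+-identityʳ _)) (m<n⇒0<n∸m i<j))
    (subst (_< a + b) (sym (+-identityʳ _)) (≤-<-trans (m∸n≤m j i) j<a+b))
    (subst (+ n ∣_) (trans (rearrange κ (+ i) (+ j)) (cong (ℤ._+ κ ℤ.* 0ℤ) (sym (pos-∸ i<j))))
      (difference ([]-injective (+ j) (+ i) (sym (u-injective eq)))))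
    where
    u-injective : ∀ {x y : Fin n} → u x ≡ u y → x ≡ y
    u-injective refl = refl
    rearrange : ∀ κ i j → j ℤ.- i ≡ (j ℤ.- i) ℤ.+ κ ℤ.* 0ℤ
    rearrange = ℤ-solve-∀

  vs-distinct : ∀ {i j} → i < j → j ≤ b → j < a + b → vs i ≢ vs j
  vs-distinct {i} {j} i<j j≤b j<a+b eq = no-shortcut {0} {j ∸ i}
    z≤n (≤-trans (m∸n≤m j i) j≤b)
    (m<n⇒0<n∸m i<j) (≤-<-trans (m∸n≤m j i) j<a+b)
    (subst (+ n ∣_)
      (trans (rearrange κ (+ a) (+ i) (+ j)) (cong (λ d → 0ℤ ℤ.+ κ ℤ.* d) (sym (pos-∸ i<j))))
      (difference ([]-injective (+ a ℤ.+ κ ℤ.* + j) (+ a ℤ.+ κ ℤ.* + i) (sym (v-injective eq)))))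
    where
    v-injective : ∀ {x y : Fin n} → v x ≡ v y → x ≡ y
    v-injective refl = refl
    rearrange : ∀ κ a i j → (a ℤ.+ κ ℤ.* j) ℤ.- (a ℤ.+ κ ℤ.* i) ≡ 0ℤ ℤ.+ κ ℤ.* (j ℤ.- i)
    rearrange = ℤ-solve-∀

  -- An odd value below 3 is 1. The closed walk would then be a single edge, and `n` would divide
  -- `κ` or 1.
  trivial-length : a ≡ 0 ⊎ b ≡ 0 → 3 ≤ a + b
  trivial-length = bound odd
    where
    long : ∀ r → 2 * suc r + 1 ≡ 3 + 2 * r
    long = solve-∀
    κ*1 : ∀ κ → 0ℤ ℤ.+ κ ℤ.* 1ℤ ≡ κ
    κ*1 = ℤ-solve-∀
    κ*0 : ∀ κ → 1ℤ ℤ.+ κ ℤ.* 0ℤ ≡ 1ℤ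
    κ*0 = ℤ-solve-∀
    bound : Odd (a + b) → a ≡ 0 ⊎ b ≡ 0 → 3 ≤ a + b
    bound (suc r , eq) _ = subst (3 ≤_) (sym (trans eq (long r))) (m≤m+n 3 (2 * r))
    bound (zero , eq) (inj₁ a≡0) = contradiction
      (subst (+ n ∣_) (trans (cong₂ (λ a b → + a ℤ.+ κ ℤ.* + b) a≡0
        (subst (λ a → a + b ≡ 1) a≡0 eq)) (κ*1 κ)) closed) n∤κ
    bound (zero , eq) (inj₂ b≡0) = contradiction
      (subst (+ n ∣_) (trans (cong₂ (λ a b → + a ℤ.+ κ ℤ.* + b)
        (trans (sym (+-identityʳ a)) (subst (λ b → a + b ≡ 1) b≡0 eq)) b≡0) (κ*0 κ)) closed) n∤1

  -- The closing edge is one more ordinary step, since `closed` identifies the vertex after the last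
  -- one with the first.
  trivial-cycle : a ≡ 0 ⊎ b ≡ 0 → Cycle (Pet n k) (a + b)
  trivial-cycle triv@(inj₁ refl) = cycleFromSequence vs (trivial-length triv)
    (λ _ → vs-step _)
    (λ {i} i≡ → subst (Pet n k (vs i)) (wrap i≡) (vs-step i))
    (λ i<j j< → vs-distinct i<j (<⇒≤ j<) j<)
    where
    rearrange : ∀ κ x → κ ℤ.* x ≡ (0ℤ ℤ.+ κ ℤ.* x) ℤ.- (0ℤ ℤ.+ κ ℤ.* 0ℤ)
    rearrange = ℤ-solve-∀
    wrap : ∀ {i} → suc i ≡ b → vs (suc i) ≡ vs 0
    wrap refl = cong v ([]-cong (0ℤ ℤ.+ κ ℤ.* + b) (0ℤ ℤ.+ κ ℤ.* 0ℤ) (congruent (subst (+ n ∣_)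
      (trans (ℤ.+-identityˡ _) (rearrange κ (+ b))) closed)))
  trivial-cycle triv@(inj₂ refl) = cycleFromSequence us (trivial-length triv)
    (λ _ → us-step _)
    (λ {i} i≡ → subst (Pet n k (us i)) (wrap (trans i≡ (+-identityʳ a))) (us-step i))
    (λ i<j j< → us-distinct i<j (subst (_ ≤_) (+-identityʳ a) (<⇒≤ j<)) j<)
    where
    rearrange : ∀ κ x → x ℤ.+ κ ℤ.* 0ℤ ≡ x ℤ.- 0ℤ
    rearrange = ℤ-solve-∀
    wrap : ∀ {i} → suc i ≡ a → us (suc i) ≡ us 0
    wrap refl = cong u ([]-cong (+ a) 0ℤ (congruent (subst (+ n ∣_) (rearrange κ (+ a)) closed)))

  -- Both paths include their end points, hence the lengths `suc a` and `suc b`. They are joined by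
  -- the spokes at positions `a` and 0.
  nontrivial-cycle : a ≢ 0 → b ≢ 0 → Cycle (Pet n k) (suc a + suc b)
  nontrivial-cycle a≢0 b≢0 = cycleFromSequence (splice (suc a) us vs)
    (+-mono-≤ {1} {suc a} {2} (s≤s z≤n) (s≤s (n≢0⇒n>0 b≢0)))
    (splice-step (Pet n k) a us vs (λ _ → us-step _) spoke-there (λ _ → vs-step _))
    close
    (splice-distinct (suc a) us vs
      -- Index `a` itself occurs here, so `j < a + b` rests on `b ≢ 0`; for the inner path it rests
      -- on `a ≢ 0`.
      (λ { i<j (s≤s j≤a) → us-distinct i<j j≤a (≤-<-trans j≤a (m<m+n a (n≢0⇒n>0 b≢0))) })
      (λ _ _ ())
      (λ { i<j (s≤s j≤b) → vs-distinct i<j j≤b (≤-<-trans j≤b (m<n+m b (n≢0⇒n>0 a≢0))) }))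
    where
    shape : ∀ κ a → a ≡ a ℤ.+ κ ℤ.* 0ℤ
    shape = ℤ-solve-∀
    spoke-there : Pet n k (us a) (vs 0)
    spoke-there = subst (λ x → Pet n k (us a) (v [ x ])) (shape κ (+ a)) (fwd (spoke _))
    vs-end : vs b ≡ v [ 0ℤ ]
    vs-end = cong v ([]-cong (+ a ℤ.+ κ ℤ.* + b) 0ℤ
      (congruent (subst (+ n ∣_) (sym (ℤ.+-identityʳ _)) closed)))
    close : ∀ {i} → suc i ≡ suc a + suc b →
            Pet n k (splice (suc a) us vs i) (splice (suc a) us vs 0)
    close refl = subst (λ w → Pet n k w (us 0))
      (sym (trans (cong (splice (suc a) us vs) (+-suc a b))
                  (trans (splice-right (suc a) us vs b) vs-end)))
      (bwd (spoke _))

-- Edge counts of walks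

module _ {n k : ℕ} where

  open Congruence n

  side : Vertex n → ℕ
  side (u _) = 0
  side (v _) = 1

  position : Vertex n → ℤ
  position (u i) = + toℕ i
  position (v i) = + toℕ i

  displacement : (a⁺ a⁻ b⁺ b⁻ : ℤ) → ℤ
  displacement a⁺ a⁻ b⁺ b⁻ = (a⁺ ℤ.- a⁻) ℤ.+ + k ℤ.* (b⁺ ℤ.- b⁻)

  -- Statistics of a walk from w to w′: numbers of outer edges, of inner edges (each by
  -- direction) and of spokes.
  record Tally (w w′ : Vertex n) (length : ℕ) : Set where
    field
      a⁺ a⁻ b⁺ b⁻ s : ℕ
      total     : a⁺ + a⁻ + (b⁺ + b⁻) + s ≡ length
      winds     : position w ℤ.+ displacement (+ a⁺) (+ a⁻) (+ b⁺) (+ b⁻) ≋ position w′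
      crossings : ∃ λ q → side w + s ≡ side w′ + 2 * q
      unmixed   : s ≡ 0 → side w′ ≡ 0 × b⁺ + b⁻ ≡ 0 ⊎ side w′ ≡ 1 × a⁺ + a⁻ ≡ 0

    α β : ℤ
    α = + a⁺ ℤ.- + a⁻
    β = + k ℤ.* (+ b⁺ ℤ.- + b⁻)

  empty : ∀ w → Tally w w 0
  empty w = record
    { a⁺ = 0 ; a⁻ = 0 ; b⁺ = 0 ; b⁻ = 0 ; s = 0
    ; total = refl
    ; winds = subst (_≋ position w) (shape (position w) (+ k)) ≋-refl
    ; crossings = 0 , refl
    ; unmixed = λ _ → pure w
    }
    where
    shape : ∀ x k → x ≡ x ℤ.+ ((0ℤ ℤ.- 0ℤ) ℤ.+ k ℤ.* (0ℤ ℤ.- 0ℤ))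
    shape = ℤ-solve-∀
    pure : ∀ w → side w ≡ 0 × 0 ≡ 0 ⊎ side w ≡ 1 × 0 ≡ 0
    pure (u _) = inj₁ (refl , refl)
    pure (v _) = inj₂ (refl , refl)

  ⊕-back : ∀ (i : Fin n) m → + toℕ (i ⊕ m) ℤ.+ (ℤ.- + m) ≋ + toℕ i
  ⊕-back i m = subst (+ toℕ (i ⊕ m) ℤ.+ (ℤ.- + m) ≋_) (cancel (+ toℕ i) (+ m))
    (≋-+ʳ (ℤ.- + m) (toℕ-⊕ i m))
    where
    cancel : ∀ x m → (x ℤ.+ m) ℤ.+ (ℤ.- m) ≡ x
    cancel = ℤ-solve-∀

  advance : ∀ x D {D′ y z} d → D′ ≡ D ℤ.+ d → x ℤ.+ D ≋ y → y ℤ.+ d ≋ z → x ℤ.+ D′ ≋ z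
  advance x D d refl p q =
    ≋-trans (subst (_≋ _) (ℤ.+-assoc x D d) (≋-+ʳ d p)) q

  -- After an outer step the inner alternative of `unmixed` is absurd. Only that alternative
  -- mentions the count that the step changes, hence the free passage from `B` to `C`.
  keep-outer : ∀ {A B C : Set} → 0 ≡ 0 × A ⊎ 0 ≡ 1 × B → 0 ≡ 0 × A ⊎ 0 ≡ 1 × C
  keep-outer (inj₁ p) = inj₁ p

  keep-inner : ∀ {A B C : Set} → 1 ≡ 0 × A ⊎ 1 ≡ 1 × B → 1 ≡ 0 × C ⊎ 1 ≡ 1 × B
  keep-inner (inj₂ p) = inj₂ p

  extend : ∀ {w w′ w″ l} → Tally w w′ l → Pet n k w′ w″ → Tally w w″ (suc l)
  extend {w} T (fwd (outer i)) = record
    { Tally T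
    ; a⁺ = suc (T .a⁺)
    ; total = cong suc (T .total)
    ; winds = advance (position w) (α T ℤ.+ β T) 1ℤ (eq (+ T .a⁺) (+ T .a⁻) (β T))
        (T .winds) (≋-sym (toℕ-⊕ i 1))
    ; unmixed = λ s≡0 → keep-outer (T .unmixed s≡0)
    }
    where
    open Tally
    eq : ∀ a b c → ((1ℤ ℤ.+ a) ℤ.- b) ℤ.+ c ≡ ((a ℤ.- b) ℤ.+ c) ℤ.+ 1ℤ
    eq = ℤ-solve-∀
  extend {w} T (bwd (outer i)) = record
    { Tally T
    ; a⁻ = suc (T .a⁻)
    ; total = trans (shift (T .a⁺) (T .a⁻) (T .b⁺ + T .b⁻) (T .s)) (cong suc (T .total))
    ; winds = advance (position w) (α T ℤ.+ β T) (ℤ.- 1ℤ) (eq (+ T .a⁺) (+ T .a⁻) (β T))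
        (T .winds) (⊕-back i 1)
    ; unmixed = λ s≡0 → keep-outer (T .unmixed s≡0)
    }
    where
    open Tally
    shift : ∀ a b c s → a + suc b + c + s ≡ suc (a + b + c + s)
    shift = solve-∀
    eq : ∀ a b c → (a ℤ.- (1ℤ ℤ.+ b)) ℤ.+ c ≡ ((a ℤ.- b) ℤ.+ c) ℤ.+ (ℤ.- 1ℤ)
    eq = ℤ-solve-∀
  extend {w} T (fwd (inner i)) = record
    { Tally T
    ; b⁺ = suc (T .b⁺)
    ; total = trans (shift (T .a⁺ + T .a⁻) (T .b⁺) (T .b⁻) (T .s)) (cong suc (T .total))
    ; winds = advance (position w) (α T ℤ.+ β T) (+ k) (eq (+ k) (α T) (+ T .b⁺) (+ T .b⁻))
        (T .winds) (≋-sym (toℕ-⊕ i k))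
    ; unmixed = λ s≡0 → keep-inner (T .unmixed s≡0)
    }
    where
    open Tally
    shift : ∀ a b c s → a + (suc b + c) + s ≡ suc (a + (b + c) + s)
    shift = solve-∀
    eq : ∀ k a b c → a ℤ.+ k ℤ.* ((1ℤ ℤ.+ b) ℤ.- c) ≡ (a ℤ.+ k ℤ.* (b ℤ.- c)) ℤ.+ k
    eq = ℤ-solve-∀
  extend {w} T (bwd (inner i)) = record
    { Tally T
    ; b⁻ = suc (T .b⁻)
    ; total = trans (shift (T .a⁺ + T .a⁻) (T .b⁺) (T .b⁻) (T .s)) (cong suc (T .total))
    ; winds = advance (position w) (α T ℤ.+ β T) (ℤ.- + k) (eq (+ k) (α T) (+ T .b⁺) (+ T .b⁻))
        (T .winds) (⊕-back i k)
    ; unmixed = λ s≡0 → keep-inner (T .unmixed s≡0)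
    }
    where
    open Tally
    shift : ∀ a b c s → a + (b + suc c) + s ≡ suc (a + (b + c) + s)
    shift = solve-∀
    eq : ∀ k a b c → a ℤ.+ k ℤ.* (b ℤ.- (1ℤ ℤ.+ c)) ≡ (a ℤ.+ k ℤ.* (b ℤ.- c)) ℤ.+ (ℤ.- k)
    eq = ℤ-solve-∀
  extend {w} T (fwd (spoke i)) = record
    { Tally T
    ; s = suc (T .s)
    ; total = trans (+-suc _ _) (cong suc (T .total))
    ; crossings = let q , eq = T .crossings in q , trans (+-suc (side w) _) (cong suc eq)
    ; unmixed = λ ()
    }
    where open Tally
  extend {w} T (bwd (spoke i)) = record
    { Tally T
    ; s = suc (T .s)
    ; total = trans (+-suc _ _) (cong suc (T .total))
    -- This spoke leads from side 1 to side 0: the added spoke and the lost side contribute 2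
    -- together, so `q` grows by one. In the other direction the gained side balances the spoke.
    ; crossings = let q , eq = T .crossings in
        suc q , trans (+-suc (side w) _) (trans (cong suc eq) (sym (*-suc 2 q)))
    ; unmixed = λ ()
    }
    where open Tally

  walk-tally : ∀ (f : ℕ → Vertex n) → (∀ i → Pet n k (f i) (f (suc i))) →
               ∀ l → Tally (f 0) (f l) l
  walk-tally f step zero    = empty (f 0)
  walk-tally f step (suc l) = extend (walk-tally f step l) (step l)

  -- The cycle is unrolled into a sequence on `ℕ` that is periodic modulo `l`; its first `l` steps
  -- form a closed walk.
  cycle-tally : ∀ {l} → Cycle (Pet n k) l → ∃ λ w → Tally w w l
  cycle-tally {zero} record { 3≤length = () }
  cycle-tally {l@(suc _)} c = f 0 , subst (λ i → Tally (f 0) (vertex i) l) wrap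
    (walk-tally f (λ i → subst (Pet n k (f i) ∘ vertex) (next i) (adjacent _)) l)
    where
    open Cycle c
    module L = Congruence l
    f : ℕ → Vertex n
    f i = vertex L.[ + i ]
    next : ∀ i → L.[ + i ] ⊕ 1 ≡ L.[ + suc i ]
    next i = trans (L.[]-⊕ (+ i) 1) (cong (λ j → L.[ + j ]) (+-comm i 1))
    wrap : L.[ + l ] ≡ L.[ 0ℤ ]
    wrap = L.[]-cong (+ l) 0ℤ (L.congruent (divides 1ℤ
      (trans (ℤ.+-identityʳ (+ l)) (sym (ℤ.*-identityˡ (+ l))))))

  -- Feasible points from odd cycles

  -- Oddness supplies `r` and the quotient supplies `t`, so a feasible point can be handled through
  -- its three counts alone.
  mkFeasible : ∀ {a b c} → (o : Odd (a + b + c)) →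
    (d : + n ∣ + a ℤ.+ + k ℤ.* (+ b ℤ.- + c)) →
    Feasible n k (point a b c (proj₁ o) (d ._∣_.quotient))
  mkFeasible (_ , parity) (divides _ winding) = record { winding = winding ; parity = parity }

  -- The alternatives reflect whether the cycle has spokes: at least two of them leave a saving of
  -- 2, and none of them makes the point trivial.
  ShortPoint : ℕ → Set
  ShortPoint m = ∃ λ q → Feasible n k q × (objective q + 2 ≤ m ⊎ objective q ≤ m × Trivial q)

  -- Here `e` counts the cancelled pairs of opposite outer edges and `q` is half the number of
  -- spokes. Their contribution is even, so the point inherits the parity of `m`.
  shortPoint : ∀ {m} a b c e q → a + b + c + 2 * (e + q) ≡ m → Odd m →
    + n ∣ + a ℤ.+ + k ℤ.* (+ b ℤ.- + c) → (q ≡ 0 → a ≡ 0 ⊎ b + c ≡ 0) → ShortPoint m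
  shortPoint a b c e q refl odd div triv with odd-+ (a + b + c) (2 * (e + q)) odd
  ... | inj₂ (r , eq) = contradiction (trans eq (+-comm (2 * r) 1)) (even≢odd (e + q) r)
  ... | inj₁ o = _ , mkFeasible o div , cost q triv
    where
    cost : ∀ q → (q ≡ 0 → a ≡ 0 ⊎ b + c ≡ 0) →
      a + b + c + 2 ≤ a + b + c + 2 * (e + q) ⊎
      a + b + c ≤ a + b + c + 2 * (e + q) × (a ≡ 0 ⊎ b + c ≡ 0)
    cost zero    triv = inj₂ (m≤m+n _ _ , triv refl)
    cost (suc q) _    = inj₁ (+-monoʳ-≤ (a + b + c)
      (*-monoʳ-≤ 2 (≤-trans (s≤s z≤n) (m≤n+m (suc q) e))))

  cycle⇒point : ∀ {m} → Odd m → Cycle (Pet n k) m → ShortPoint m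
  cycle⇒point odd c with cycle-tally c
  ... | w , record { a⁺ = a⁺ ; a⁻ = a⁻ ; b⁺ = b⁺ ; b⁻ = b⁻ ; s = s ; total = total
                   ; winds = congruent winds ; crossings = q , crossings ; unmixed = unmixed }
    -- The walk is closed, so both sides of `crossings` carry the same `side w`, and cancelling it
    -- leaves `s ≡ 2 * q`.
    with +-cancelˡ-≡ (side w) _ _ crossings | ≤-total a⁻ a⁺
  ... | refl | inj₁ a⁻≤a⁺ with m≤n⇒∃[o]m+o≡n a⁻≤a⁺
  ...   | a , refl = shortPoint a b⁺ b⁻ a⁻ q (trans (eq a b⁺ b⁻ a⁻ q) total) odd
    (subst (+ n ∣_) (shape (position w) (+ a) (+ a⁻) (+ k) (+ b⁺) (+ b⁻)) winds) triv
    where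
    eq : ∀ a b c e q → a + b + c + 2 * (e + q) ≡ e + a + e + (b + c) + 2 * q
    eq = solve-∀
    shape : ∀ x a e k b c → (x ℤ.+ (((e ℤ.+ a) ℤ.- e) ℤ.+ k ℤ.* (b ℤ.- c))) ℤ.- x
                          ≡ a ℤ.+ k ℤ.* (b ℤ.- c)
    shape = ℤ-solve-∀
    triv : q ≡ 0 → a ≡ 0 ⊎ b⁺ + b⁻ ≡ 0
    triv refl with unmixed refl
    ... | inj₁ (_ , b≡0) = inj₂ b≡0
    ... | inj₂ (_ , a≡0) = inj₁ (m+n≡0⇒n≡0 a⁻ (m+n≡0⇒m≡0 (a⁻ + a) a≡0))
  cycle⇒point odd c
      | w , record { a⁺ = a⁺ ; a⁻ = a⁻ ; b⁺ = b⁺ ; b⁻ = b⁻ ; s = s ; total = total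
                   ; winds = congruent winds ; crossings = q , crossings ; unmixed = unmixed }
      | refl | inj₂ a⁺≤a⁻ with m≤n⇒∃[o]m+o≡n a⁺≤a⁻
  -- The net outer motion is backward, so the cycle is read in reverse: `winds` is negated and the
  -- two inner counts are swapped.
  ...   | a , refl = shortPoint a b⁻ b⁺ a⁺ q (trans (eq a b⁺ b⁻ a⁺ q) total) odd
    (subst (+ n ∣_) (shape (position w) (+ a) (+ a⁺) (+ k) (+ b⁺) (+ b⁻)) (∣m⇒∣-m winds)) triv
    where
    eq : ∀ a b c e q → a + c + b + 2 * (e + q) ≡ e + (e + a) + (b + c) + 2 * q
    eq = solve-∀
    shape : ∀ x a e k b c → ℤ.- ((x ℤ.+ ((e ℤ.- (e ℤ.+ a)) ℤ.+ k ℤ.* (b ℤ.- c))) ℤ.- x)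
                          ≡ a ℤ.+ k ℤ.* (c ℤ.- b)
    shape = ℤ-solve-∀
    triv : q ≡ 0 → a ≡ 0 ⊎ b⁻ + b⁺ ≡ 0
    triv refl with unmixed refl
    ... | inj₁ (_ , b≡0) = inj₂ (trans (+-comm b⁻ b⁺) b≡0)
    ... | inj₂ (_ , a≡0) = inj₁ (m+n≡0⇒n≡0 a⁺ (m+n≡0⇒n≡0 a⁺ a≡0))

-- Existence and shape of minimizers

odd? : ∀ m → Dec (Odd m)
odd? m with even-or-odd m
... | inj₂ o = yes o
... | inj₁ (q , refl) = no λ (r , eq) → even≢odd q r (trans eq (+-comm (2 * r) 1))

2r+3-odd : ∀ r → 2 * r + 3 ≡ 2 * suc r + 1
2r+3-odd = solve-∀

odd-gap : ∀ r r′ → 2 * r + 1 < 2 * r′ + 1 → 2 * r + 3 ≤ 2 * r′ + 1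
odd-gap r r′ lt = subst (_≤ 2 * r′ + 1) (sym (2r+3-odd r))
  (+-monoˡ-≤ 1 (*-monoʳ-≤ 2 (*-cancelˡ-< 2 r r′ (+-cancelʳ-< 1 _ _ lt))))

module _ {n k : ℕ} where

  -- Each count of a point of value below `N` is itself below `N`, so a finite search decides this.
  -- It tells the descent to a minimizer when to stop.
  shorter? : ∀ N → Dec (∃ λ q → Feasible n k q × objective q < N)
  shorter? N = Dec.map′ to from
    (anyUpTo? (λ a → anyUpTo? (λ b → anyUpTo? (λ c →
      odd? (a + b + c) ×-dec (+ n ∣? + a ℤ.+ + k ℤ.* (+ b ℤ.- + c)) ×-dec (a + b + c <? N))
      N) N) N)
    where
    to : _ → _
    to (a , _ , b , _ , c , _ , o , d , lt) = _ , mkFeasible o d , lt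
    from : (∃ λ q → Feasible n k q × objective q < N) → _
    from (point a b c r t , record { winding = winding ; parity = parity } , lt) =
      a , ≤-<-trans (≤-trans (m≤m+n a b) (m≤m+n (a + b) c)) lt ,
      b , ≤-<-trans (≤-trans (m≤n+m b a) (m≤m+n (a + b) c)) lt ,
      c , ≤-<-trans (m≤n+m c (a + b)) lt ,
      (r , parity) , divides t winding , lt

  feasible⇒solution : ∀ p → Feasible n k p → ∃ λ q → Solution n k q
  feasible⇒solution p = <-rec
    (λ N → ∀ p → objective p ≡ N → Feasible n k p → ∃ λ q → Solution n k q)
    descend (objective p) p refl
    where
    descend : ∀ N → (∀ {M} → M < N → ∀ p → objective p ≡ M → Feasible n k p → _) →
              ∀ p → objective p ≡ N → Feasible n k p → _
    descend N rec p refl fp with shorter? N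
    ... | yes (q , fq , lt) = rec lt q refl fq
    ... | no none = p , record
      { feasible = fp ; minimal = λ q fq → ≮⇒≥ (λ lt → none (q , fq , lt)) }

  -- If both inner counts were positive, lowering each by one would keep the winding and the parity
  -- and reduce the value by 2.
  solution-oneSided : ∀ p → Solution n k p → 𝗏₊ p ≡ 0 ⊎ 𝗏₋ p ≡ 0
  solution-oneSided (point a zero    c       r t) _ = inj₁ refl
  solution-oneSided (point a (suc b) zero    r t) _ = inj₂ refl
  solution-oneSided (point a (suc b) (suc c) r t)
    record { feasible = record { winding = winding ; parity = parity } ; minimal = minimal }
    with odd-+ (a + b + c) 2 (r , trans (shape a b c) parity)
    where
    shape : ∀ a b c → a + b + c + 2 ≡ a + suc b + suc c
    shape = solve-∀
  ... | inj₂ (r′ , eq) = contradiction (trans eq (+-comm (2 * r′) 1)) (even≢odd 1 r′)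
  ... | inj₁ o = contradiction
    (minimal _ (mkFeasible o (divides t (trans (cancel (+ a) (+ b) (+ c) (+ k)) winding))))
    (<⇒≱ (+-mono-≤-< (+-monoʳ-≤ a (n≤1+n b)) (n<1+n c)))
    where
    cancel : ∀ a b c k → a ℤ.+ k ℤ.* (b ℤ.- c)
                       ≡ a ℤ.+ k ℤ.* ((1ℤ ℤ.+ b) ℤ.- (1ℤ ℤ.+ c))
    cancel = ℤ-solve-∀

-- Odd girth: attainment and lower bounds

module _ (n k : ℕ) (2<2k : 2 < 2 * k) (2k≤n : 2 * k ≤ n) where

  private
    1<k : 1 < k
    1<k = *-cancelˡ-< 2 1 k 2<2k

    k<n : k < n
    k<n = <-≤-trans (m<m+n k (≤-trans (<⇒≤ 1<k) (m≤m+n k 0))) 2k≤n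

    n∤1 : ¬ (+ n ∣ 1ℤ)
    n∤1 n∣1 = contradiction (∣∧<⇒≡0 (∣⇒∣ᵤ n∣1) (<-trans 1<k k<n)) λ ()

    n∤k : ¬ (+ n ∣ + k)
    n∤k n∣k = contradiction (∣∧<⇒≡0 (∣⇒∣ᵤ n∣k) k<n) (m<n⇒n≢0 1<k)

    n∤-k : ¬ (+ n ∣ ℤ.- + k)
    n∤-k n∣-k = n∤k (subst (+ n ∣_) (ℤ.neg-involutive (+ k)) (∣m⇒∣-m n∣-k))

    instance
      n≢0 : NonZero n
      n≢0 = ≢-nonZero (m<n⇒n≢0 k<n)

    open Congruence n

    forward : ∀ x → Pet n k (v [ x ]) (v [ x ℤ.+ + k ])
    forward x = subst (Pet n k (v [ x ]) ∘ v) ([]-⊕ x k) (fwd (inner [ x ]))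

    backward : ∀ x → Pet n k (v [ x ]) (v [ x ℤ.+ (ℤ.- + k) ])
    backward x = subst (λ i → Pet n k (v i) (v [ x ℤ.+ (ℤ.- + k) ]))
      (trans ([]-⊕ (x ℤ.+ (ℤ.- + k)) k) (cong [_] (cancel x (+ k)))) (bwd (inner _))
      where
      cancel : ∀ x k → (x ℤ.+ (ℤ.- k)) ℤ.+ k ≡ x
      cancel = ℤ-solve-∀

    suc+suc : ∀ a b r → a + b ≡ 2 * r + 1 → suc a + suc b ≡ 2 * r + 3
    suc+suc a b r eq = trans (cong suc (+-suc a b)) (trans (cong (suc ∘ suc) eq) (shape r))
      where
      shape : ∀ r → 2 + (2 * r + 1) ≡ 2 * r + 3
      shape = solve-∀

  -- A one-sided solution is a pair of counts together with the sign of `κ`. Minimality among all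
  -- points restricts to pairs with the same sign, as `Construction` requires.
  solution⇒cycle : ∀ p → Solution n k p →
    (Trivial p → Cycle (Pet n k) (2 * r p + 1)) ×
    (Nontrivial p → Cycle (Pet n k) (2 * r p + 3))
  solution⇒cycle p sol with solution-oneSided p sol
  solution⇒cycle (point a b .0 r t)
    record { feasible = record { winding = winding ; parity = parity } ; minimal = minimal }
    | inj₂ refl =
      (λ triv → subst (Cycle _) a+b
        (trivial-cycle (subst (λ b → a ≡ 0 ⊎ b ≡ 0) (+-identityʳ b) triv))) ,
      (λ nontriv → subst (Cycle _) (suc+suc a b r a+b)
        (nontrivial-cycle (nontriv ∘ inj₁) (nontriv ∘ inj₂ ∘ trans (+-identityʳ b))))
    where
    a+b : a + b ≡ 2 * r + 1
    a+b = trans (sym (+-identityʳ (a + b))) parity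
    shape : ∀ a b k → a ℤ.+ k ℤ.* b ≡ a ℤ.+ k ℤ.* (b ℤ.- 0ℤ)
    shape = ℤ-solve-∀
    open Construction {n} {k} (+ k) forward n∤1 n∤k a b (r , a+b)
      (divides t (trans (shape (+ a) (+ b) (+ k)) winding))
      (λ a′ b′ o d → subst₂ _≤_ (+-identityʳ (a + b)) (+-identityʳ (a′ + b′))
        (minimal _ (mkFeasible (subst Odd (sym (+-identityʳ (a′ + b′))) o)
          (subst (+ n ∣_) (shape (+ a′) (+ b′) (+ k)) d))))
  solution⇒cycle (point a .0 b r t)
    record { feasible = record { winding = winding ; parity = parity } ; minimal = minimal }
    | inj₁ refl =
      (λ triv → subst (Cycle _) a+b (trivial-cycle triv)) ,
      (λ nontriv → subst (Cycle _) (suc+suc a b r a+b)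
        (nontrivial-cycle (nontriv ∘ inj₁) (nontriv ∘ inj₂)))
    where
    a+0+b : ∀ a b → a + 0 + b ≡ a + b
    a+0+b a b = cong (_+ b) (+-identityʳ a)
    a+b : a + b ≡ 2 * r + 1
    a+b = trans (sym (a+0+b a b)) parity
    shape : ∀ a b k → a ℤ.+ (ℤ.- k) ℤ.* b ≡ a ℤ.+ k ℤ.* (0ℤ ℤ.- b)
    shape = ℤ-solve-∀
    open Construction {n} {k} (ℤ.- + k) backward n∤1 n∤-k a b (r , a+b)
      (divides t (trans (shape (+ a) (+ b) (+ k)) winding))
      (λ a′ b′ o d → subst₂ _≤_ (a+0+b a b) (a+0+b a′ b′)
        (minimal _ (mkFeasible (subst Odd (sym (a+0+b a′ b′)) o)
          (subst (+ n ∣_) (shape (+ a′) (+ b′) (+ k)) d))))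

  feasible⇒oddCycle : ∀ p → Feasible n k p → HasOddCycle (Pet n k)
  feasible⇒oddCycle p fp with feasible⇒solution p fp
  ... | q , sol with trivial? | solution⇒cycle q sol
    where
    trivial? : Dec (Trivial q)
    trivial? = (𝗎 q ≟ 0) ⊎-dec (𝗏₊ q + 𝗏₋ q ≟ 0)
  ...   | yes triv | short , _ = _ , (r q , refl) , short triv
  ...   | no ¬triv | _ , long  = _ , (suc (r q) , 2r+3-odd (r q)) , long ¬triv

  module _ {p : Point} (sol : Solution n k p) where

    open Solution sol
    open Feasible feasible renaming (parity to p-odd) hiding (winding)

    shortest : ∀ m → Odd m → Cycle (Pet n k) m → 2 * r p + 1 ≤ m
    shortest m odd c with cycle⇒point odd c
    ... | q , fq , cost = subst (_≤ m) p-odd (≤-trans (minimal q fq) (bound cost))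
      where
      bound : objective q + 2 ≤ m ⊎ objective q ≤ m × Trivial q → objective q ≤ m
      bound (inj₁ q+2≤m)   = ≤-trans (m≤m+n _ 2) q+2≤m
      bound (inj₂ (q≤m , _)) = q≤m

    -- A trivial point obtained from the cycle cannot be optimal, so the optimum is strictly below
    -- `m`; both are odd, which gives the gap of 2.
    shortest-nontrivial : (∀ q → Solution n k q → Nontrivial q) →
      ∀ m → Odd m → Cycle (Pet n k) m → 2 * r p + 3 ≤ m
    shortest-nontrivial nontriv m (r′ , refl) c with cycle⇒point (r′ , refl) c
    ... | q , fq , inj₁ q+2≤m = begin
      2 * r p + 3      ≡⟨ +-assoc (2 * r p) 1 2 ⟨
      2 * r p + 1 + 2  ≡⟨ cong (_+ 2) p-odd ⟨
      objective p + 2  ≤⟨ +-monoˡ-≤ 2 (minimal q fq) ⟩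
      objective q + 2  ≤⟨ q+2≤m ⟩
      m                ∎
      where open ≤-Reasoning
    ... | q , fq , inj₂ (q≤m , triv) with m≤n⇒m<n∨m≡n (minimal q fq)
    ...   | inj₁ p<q = odd-gap (r p) r′ (subst (_< 2 * r′ + 1) p-odd (<-≤-trans p<q q≤m))
    ...   | inj₂ p≡q = contradiction triv (nontriv q record
      { feasible = fq ; minimal = λ q′ fq′ → subst (_≤ objective q′) p≡q (minimal q′ fq′) })

theorem8 : ∀ (n k : ℕ) → 2 < 2 * k → 2 * k ≤ n →
    ((∃ λ p → Feasible n k p) ⇔ HasOddCycle (Pet n k))
    × (∀ p → Solution n k p →
    ((∃ λ q → Solution n k q × Trivial q) →
    IsOddGirth (Pet n k) (2 * r p + 1))
    × ((∀ q → Solution n k q → Nontrivial q) →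
    IsOddGirth (Pet n k) (2 * r p + 3)))
theorem8 n k 2<2k 2k≤n =
  mk⇔ (λ (p , fp) → feasible⇒oddCycle n k 2<2k 2k≤n p fp)
      (λ (m , odd , c) → let q , fq , _ = cycle⇒point odd c in q , fq) ,
  λ p sol →
    (λ (q , sol-q , triv) → record
      { odd      = r p , refl
      -- The trivial solution `q` may differ from `p`; the cycle is built from `q` and its length
      -- transferred, as all solutions have the same value.
      ; attained = subst (Cycle (Pet n k)) (sym (same-value sol sol-q))
          (proj₁ (solution⇒cycle n k 2<2k 2k≤n q sol-q) triv)
      ; minimal  = shortest n k 2<2k 2k≤n sol
      }) ,
    (λ nontriv → record
      { odd      = suc (r p) , 2r+3-odd (r p)
      ; attained = proj₂ (solution⇒cycle n k 2<2k 2k≤n p sol) (nontriv p sol)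
      ; minimal  = shortest-nontrivial n k 2<2k 2k≤n sol nontriv
      })
  where
  open Solution
  open Feasible
  same-value : ∀ {p q} → Solution n k p → Solution n k q → 2 * r p + 1 ≡ 2 * r q + 1
  same-value {p} {q} P Q = trans (sym (P .feasible .parity))
    (trans (≤-antisym (P .minimal q (Q .feasible)) (Q .minimal p (P .feasible)))
           (Q .feasible .parity))
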